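{- Let $p>2$ be prime. For $t\in\mathbb{Z}/p\mathbb{Z}$ put $a_t(p)=-\sum_{x\bmod p}\left(\frac{x^3-t^2x+t^2}{p}\right)$. Then $\sum_{t\bmod p} a_t(p) = -2p$.
   Context: $\left(\frac{\cdot}{p}\right)$ denotes the Legendre symbol (equal to $0$ at multiples of $p$). -}

module Defs where

open import Algebra.Properties.CommutativeMonoid.Sum using (sum-cong-≗)
open import Data.Bool.Base using (if_then_else_)
open import Data.Fin.Base using (Fin; toℕ)
open import Data.Fin.Properties using (any?)
open import Data.Integer.Base using (ℤ; +_; -_; _+_; _-_; _*_; _^_; 0ℤ; 1ℤ; -1ℤ)
open import Data.Integer.Divisibility.Signed using (_∣_; _∣?_; ∣m∣n⇒∣m+n; ∣m⇒∣-m; ∣n⇒∣m*n)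
open import Data.Integer.Properties using (+-0-commutativeMonoid)
open import Data.Integer.Tactic.RingSolver using (solve-∀)
open import Data.Nat.Base using (ℕ)
open import Data.Product.Base using (∃; _,_)
open import Function.Bundles using (mk⇔)
open import Relation.Binary.PropositionalEquality using (_≡_; cong; cong₂; subst)
open import Relation.Nullary.Decidable using (Dec; does; does-⇔)

open import Algebra.Properties.CommutativeMonoid.Sum +-0-commutativeMonoid public using (sum-syntax)

-- ℤ/pℤ is represented by the residues 0, …, p - 1.
residue : ∀ {p} → Fin p → ℤ
residue x = + toℕ x

infix 4 _≡_[mod_]

_≡_[mod_] : ℤ → ℤ → ℕ → Set
a ≡ b [mod p ] = + p ∣ a - b

IsSquareMod : ℕ → ℤ → Set
IsSquareMod p a = ∃ λ (y : Fin p) → residue y ^ 2 ≡ a [mod p ]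

isSquareMod? : ∀ p a → Dec (IsSquareMod p a)
isSquareMod? p a = any? λ y → + p ∣? residue y ^ 2 - a

legendre : ℤ → ℕ → ℤ
legendre a p =
  if does (+ p ∣? a) then 0ℤ
  else if does (isSquareMod? p a) then 1ℤ
  else -1ℤ

cubic : ℤ → ℤ → ℤ
cubic t x = x ^ 3 - t ^ 2 * x + t ^ 2

a⟨_⟩ : ℤ → ℕ → ℤ
a⟨ t ⟩ p = - (∑[ x < p ] legendre (cubic t (residue x)) p)

-- The Legendre symbol and a⟨_⟩ depend only on the class mod p.

≡mod-sym : ∀ p {a b} → a ≡ b [mod p ] → b ≡ a [mod p ]
≡mod-sym p {a} {b} a≡b = subst (+ p ∣_) (lemma a b) (∣m⇒∣-m a≡b)
  where
  lemma : ∀ a b → - (a - b) ≡ b - a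
  lemma = solve-∀

legendre-cong : ∀ p {a b} → a ≡ b [mod p ] → legendre a p ≡ legendre b p
legendre-cong p {a} {b} a≡b = cong₂ (λ u v → if u then 0ℤ else if v then 1ℤ else -1ℤ)
  (does-⇔ (mk⇔ (div a≡b) (div b≡a)) (+ p ∣? a) (+ p ∣? b))
  (does-⇔ (mk⇔ (square a≡b) (square b≡a)) (isSquareMod? p a) (isSquareMod? p b))
  where
  b≡a : b ≡ a [mod p ]
  b≡a = ≡mod-sym p {a} {b} a≡b

  add : ∀ s c d → (s - c) + (c - d) ≡ s - d
  add = solve-∀

  cancel : ∀ c d → c + - (c - d) ≡ d
  cancel = solve-∀

  div : ∀ {c d} → c ≡ d [mod p ] → + p ∣ c → + p ∣ d
  div {c} {d} c≡d p∣c = subst (+ p ∣_) (cancel c d) (∣m∣n⇒∣m+n p∣c (∣m⇒∣-m c≡d))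

  square : ∀ {c d} → c ≡ d [mod p ] → IsSquareMod p c → IsSquareMod p d
  square {c} {d} c≡d (y , y²≡c) =
    y , subst (+ p ∣_) (add (residue y ^ 2) c d) (∣m∣n⇒∣m+n y²≡c c≡d)

a-cong : ∀ p {s t} → s ≡ t [mod p ] → a⟨ s ⟩ p ≡ a⟨ t ⟩ p
a-cong p {s} {t} s≡t = cong -_ (sum-cong-≗ +-0-commutativeMonoid {p} λ x →
  legendre-cong p {cubic s (residue x)} {cubic t (residue x)}
    (subst (+ p ∣_) (factor (residue x) s t)
      (∣n⇒∣m*n ((1ℤ - residue x) * (s + t)) s≡t)))
  where
  lemma : ∀ x x³ s t → (1ℤ - x) * (s + t) * (s - t) ≡
          (x³ - s * (s * 1ℤ) * x + s * (s * 1ℤ)) - (x³ - t * (t * 1ℤ) * x + t * (t * 1ℤ))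
  lemma = solve-∀

  factor : ∀ x s t → (1ℤ - x) * (s + t) * (s - t) ≡ cubic s x - cubic t x
  factor x s t = lemma x (x ^ 3) s t

{-# OPTIONS --safe #-}
-- Since a⟨ t ⟩ p is p minus the number of pairs (x , y) with y² = cubic t x, the sum over t is p² minus the
-- number of triples (t , x , y) with y² = x³ - t²x + t².  Substituting t = xs and y = xv turns this
-- equation, for x ≠ 0, into (1 - s²)x = v² - s²; for x = 0 both equations read y² = t².
-- Now count x first: it is unique if s² ≠ 1, so such an s contributes p triples, whereas s = ±1 forces
-- v = ±1 and leaves x free, contributing 2p.  The number of triples is therefore p² + 2p.
module Submission where

open import Defs
open import Algebra.Properties.CommutativeMonoid.Sum using (sum-cong-≗; sum-remove; ∑-comm; ∑-distrib-+)
open import Algebra.Properties.Semiring.Sum using (*-distribˡ-sum; *-distribʳ-sum)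
open import Data.Bool.Base using (if_then_else_)
open import Data.Fin.Base using (Fin; toℕ; fromℕ<; punchIn)
open import Data.Fin.Properties using (toℕ<n; toℕ-fromℕ<; toℕ-injective; punchInᵢ≢i)
open import Data.Integer.Base using (ℤ; +_; -[1+_]; -_; _+_; _-_; _*_; _^_; 0ℤ; 1ℤ; -1ℤ; ∣_∣)
open import Data.Integer.DivMod using (_/ℕ_; _%ℕ_; n%ℕd<d; a≡a%ℕn+[a/ℕn]*n)
open import Data.Integer.Divisibility.Signed
open import Data.Integer.Properties
  using (+-0-commutativeMonoid; +-*-semiring; pos-*; abs-*; m-n≡m⊖n; ∣m⊝n∣≤m⊔n; ∣i∣≡0⇒i≡0; i-j≡0⇒i≡j;
         +-injective; +-identityʳ; *-identityˡ; *-identityʳ; *-comm)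
open import Data.Integer.Tactic.RingSolver using (solve-∀)
import Data.Nat.Base as ℕ
open import Data.Nat.Base using (ℕ; _<_)
open import Data.Nat.Coprimality using (Coprime; coprime-Bézout)
import Data.Nat.Divisibility as ℕ
import Data.Nat.Properties as ℕ
open import Data.Nat.GCD using (module Bézout)
open import Data.Nat.Primality using (Prime; euclidsLemma; prime⇒nonZero; prime⇒nonTrivial; prime⇒irreducible)
open import Data.Product.Base using (∃; _,_; proj₁; proj₂)
open import Data.Sum.Base using (_⊎_; inj₁; inj₂; [_,_]′)
open import Function.Base using (_∘_)
open import Function.Bundles using (mk⇔)
open import Relation.Binary.PropositionalEquality
  using (_≡_; _≢_; refl; sym; trans; cong; cong₂; subst; module ≡-Reasoning)
open import Relation.Nullary.Decidable using (Dec; yes; no; does; does-⇔; dec-true; dec-false)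
open import Relation.Nullary.Negation using (¬_; contradiction)

open ≡-Reasoning

private
  M = +-0-commutativeMonoid

-- Finite sums of integers.

∑-cong : ∀ {n} {f g : Fin n → ℤ} → (∀ i → f i ≡ g i) → ∑[ i < n ] f i ≡ ∑[ i < n ] g i
∑-cong = sum-cong-≗ M

∑-const : ∀ n c → ∑[ i < n ] c ≡ + n * c
∑-const ℕ.zero    c = refl
∑-const (ℕ.suc n) c = trans (cong (_+_ c) (∑-const n c)) (lemma c (+ n))
  where
  lemma : ∀ c k → c + k * c ≡ (1ℤ + k) * c
  lemma = solve-∀

∑-zero : ∀ {n} {f : Fin n → ℤ} → (∀ i → f i ≡ 0ℤ) → ∑[ i < n ] f i ≡ 0ℤ
∑-zero {n} f≡0 = trans (∑-cong f≡0) (trans (∑-const n 0ℤ) (*-comm (+ n) 0ℤ))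

∑-single : ∀ {n} (f : Fin n → ℤ) i → (∀ j → j ≢ i → f j ≡ 0ℤ) → ∑[ j < n ] f j ≡ f i
∑-single {ℕ.suc n} f i f≡0 = begin
  ∑[ j < ℕ.suc n ] f j              ≡⟨ sum-remove M {i = i} f ⟩
  f i + ∑[ j < n ] f (punchIn i j)  ≡⟨ cong (_+_ (f i)) (∑-zero λ j → f≡0 (punchIn i j) (punchInᵢ≢i i j)) ⟩
  f i + 0ℤ                          ≡⟨ +-identityʳ (f i) ⟩
  f i                               ∎

-- Indicators of divisibility by p.

abstract
  -- The solution counts are sums of these. The divisibility test is kept opaque, so that counts are
  -- handled only through the two values and the invariance of the indicator.
  indicator : ℕ → ℤ → ℤ
  indicator p a = if does (+ p ∣? a) then 1ℤ else 0ℤ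

module _ {p : ℕ} where

  abstract
    indicator-yes : ∀ {a} → + p ∣ a → indicator p a ≡ 1ℤ
    indicator-yes {a} p∣a rewrite dec-true (+ p ∣? a) p∣a = refl

    indicator-no : ∀ {a} → ¬ + p ∣ a → indicator p a ≡ 0ℤ
    indicator-no {a} p∤a rewrite dec-false (+ p ∣? a) p∤a = refl

    indicator-⇔ : ∀ {a b} → (+ p ∣ a → + p ∣ b) → (+ p ∣ b → + p ∣ a) → indicator p a ≡ indicator p b
    indicator-⇔ {a} {b} f g = cong (λ u → if u then 1ℤ else 0ℤ) (does-⇔ (mk⇔ f g) (+ p ∣? a) (+ p ∣? b))

  -- The cofactor matters only where the indicator is 1, so it may be rewritten under the assumption
  -- that p divides `a`.
  indicator-* : ∀ {a u v} → (+ p ∣ a → u ≡ v) → indicator p a * u ≡ indicator p a * v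
  indicator-* {a} {u} {v} u≡v with + p ∣? a
  ... | yes p∣a = cong (indicator p a *_) (u≡v p∣a)
  ... | no  p∤a = trans (cong (_* u) (indicator-no p∤a)) (sym (cong (_* v) (indicator-no p∤a)))

  -- If a + b ≡ 0, either summand vanishes mod p exactly when the other does. This compares two
  -- equations that agree mod p up to sign.
  indicator-+ : ∀ {a b} → + p ∣ a + b → indicator p a ≡ indicator p b
  indicator-+ p∣a+b = indicator-⇔ (∣m+n∣m⇒∣n p∣a+b) (∣m+n∣n⇒∣m p∣a+b)

  indicator-cong : ∀ {a b} → a ≡ b [mod p ] → indicator p a ≡ indicator p b
  indicator-cong {a} {b} a≡b = indicator-⇔
    (λ p∣a → subst (+ p ∣_) (lemma a b) (∣m∣n⇒∣m-n p∣a a≡b))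
    (λ p∣b → ∣m+n∣n⇒∣m a≡b (∣m⇒∣-m p∣b))
    where
    lemma : ∀ a b → a - (a - b) ≡ b
    lemma = solve-∀

  -- Values of the Legendre symbol and representatives of residue classes.

  legendre-zero : ∀ {u} → + p ∣ u → legendre u p ≡ 0ℤ
  legendre-zero {u} p∣u rewrite dec-true (+ p ∣? u) p∣u = refl

  legendre-square : ∀ {u} → ¬ + p ∣ u → IsSquareMod p u → legendre u p ≡ 1ℤ
  legendre-square {u} p∤u sq
    rewrite dec-false (+ p ∣? u) p∤u | dec-true (isSquareMod? p u) sq = refl

  legendre-nonsquare : ∀ {u} → ¬ + p ∣ u → ¬ IsSquareMod p u → legendre u p ≡ -1ℤ
  legendre-nonsquare {u} p∤u nsq
    rewrite dec-false (+ p ∣? u) p∤u | dec-false (isSquareMod? p u) nsq = refl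

  -- Two numbers below p differ by less than p in absolute value, and the only multiple of p of that
  -- size is 0.
  residue-injective : ∀ {i j : Fin p} → residue i ≡ residue j [mod p ] → i ≡ j
  residue-injective {i} {j} i≡j =
    toℕ-injective (+-injective (i-j≡0⇒i≡j _ _ (∣i∣≡0⇒i≡0 (small (∣⇒∣ᵤ i≡j) bound))))
    where
    small : ∀ {m} → p ℕ.∣ m → m < p → m ≡ 0
    small {ℕ.zero}  _   _   = refl
    small {ℕ.suc m} p∣m m<p = contradiction p∣m (ℕ.>⇒∤ m<p)

    bound : ∣ residue i - residue j ∣ < p
    bound = subst (λ z → ∣ z ∣ < p) (sym (m-n≡m⊖n (toℕ i) (toℕ j)))
      (ℕ.≤-<-trans (∣m⊝n∣≤m⊔n (toℕ i) (toℕ j)) (ℕ.⊔-lub (toℕ<n i) (toℕ<n j)))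

  -- Division with remainder: the remainder of `c` is the representative, and the negated quotient
  -- witnesses the congruence.
  residue-surjective : .{{_ : ℕ.NonZero p}} → ∀ c → ∃ λ (i : Fin p) → residue i ≡ c [mod p ]
  residue-surjective c = fromℕ< r<p , divides (- (c /ℕ p)) (begin
    + toℕ (fromℕ< r<p) - c                         ≡⟨ cong (λ r → + r - c) (toℕ-fromℕ< r<p) ⟩
    + (c %ℕ p) - c                                 ≡⟨ cong (_-_ (+ (c %ℕ p))) (a≡a%ℕn+[a/ℕn]*n c p) ⟩
    + (c %ℕ p) - (+ (c %ℕ p) + (c /ℕ p) * + p)     ≡⟨ lemma (+ (c %ℕ p)) (c /ℕ p) (+ p) ⟩
    - (c /ℕ p) * + p                               ∎)
    where
    r<p : c %ℕ p < p
    r<p = n%ℕd<d c p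

    lemma : ∀ r q k → r - (r + q * k) ≡ - q * k
    lemma = solve-∀

-- Linear congruences modulo a prime.

module _ {p : ℕ} (pr : Prime p) where

  private instance
    p≢0 : ℕ.NonZero p
    p≢0 = prime⇒nonZero pr

  ∣*-split : ∀ a b → + p ∣ a * b → (+ p ∣ a) ⊎ (+ p ∣ b)
  ∣*-split a b p∣ab
    with euclidsLemma ∣ a ∣ ∣ b ∣ pr (subst (p ℕ.∣_) (abs-* a b) (∣⇒∣ᵤ p∣ab))
  ... | inj₁ p∣a = inj₁ (∣ᵤ⇒∣ p∣a)
  ... | inj₂ p∣b = inj₂ (∣ᵤ⇒∣ p∣b)

  ∣*-cancelˡ : ∀ {a b} → ¬ + p ∣ a → + p ∣ a * b → + p ∣ b
  ∣*-cancelˡ {a} {b} p∤a p∣ab = [ (λ p∣a → contradiction p∣a p∤a) , (λ p∣b → p∣b) ]′ (∣*-split a b p∣ab)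

  -- A number not divisible by the prime p is coprime to p, so a Bézout identity yields the inverse.
  inverse : ∀ a → ¬ + p ∣ a → ∃ λ b → a * b ≡ 1ℤ [mod p ]
  inverse (+ n) p∤n with coprime-Bézout coprime
    where
    coprime : Coprime n p
    coprime (d∣n , d∣p) with prime⇒irreducible pr d∣p
    ... | inj₁ d≡1  = d≡1
    ... | inj₂ refl = contradiction (∣ᵤ⇒∣ d∣n) p∤n
  -- Here 1 + yp = xn, so x itself inverts n.
  ... | Bézout.+- x y eq = + x , divides (+ y) (begin
    + n * + x - 1ℤ          ≡⟨ cong (_- 1ℤ) (*-comm (+ n) (+ x)) ⟩
    + x * + n - 1ℤ          ≡⟨ cong (_- 1ℤ) (pos-* x n) ⟨
    + (x ℕ.* n) - 1ℤ        ≡⟨ cong (λ k → + k - 1ℤ) eq ⟨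
    1ℤ + + (y ℕ.* p) - 1ℤ   ≡⟨ cong (λ k → 1ℤ + k - 1ℤ) (pos-* y p) ⟩
    1ℤ + + y * + p - 1ℤ     ≡⟨ lemma (+ y * + p) ⟩
    + y * + p               ∎)
    where
    lemma : ∀ k → 1ℤ + k - 1ℤ ≡ k
    lemma = solve-∀
  -- Here 1 + xn = yp, so xn ≡ -1 and the inverse is -x.
  ... | Bézout.-+ x y eq = - + x , divides (- + y) (begin
    + n * - + x - 1ℤ        ≡⟨ lemma (+ n) (+ x) ⟩
    - (1ℤ + + x * + n)      ≡⟨ cong (λ k → - (1ℤ + k)) (pos-* x n) ⟨
    - (1ℤ + + (x ℕ.* n))    ≡⟨ cong (λ k → - + k) eq ⟩
    - + (y ℕ.* p)           ≡⟨ cong -_ (pos-* y p) ⟩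
    - (+ y * + p)           ≡⟨ neg (+ y) (+ p) ⟩
    - + y * + p             ∎)
    where
    lemma : ∀ n x → n * - x - 1ℤ ≡ - (1ℤ + x * n)
    lemma = solve-∀

    neg : ∀ y k → - (y * k) ≡ - y * k
    neg = solve-∀
  inverse a@(-[1+ n ]) p∤a =
    let b , ab≡1 = inverse (+ ℕ.suc n) (λ p∣-a → p∤a (∣m⇒∣-m p∣-a))
    in - b , subst (+ p ∣_) (lemma (+ ℕ.suc n) b) ab≡1
    where
    lemma : ∀ a b → a * b - 1ℤ ≡ - a * - b - 1ℤ
    lemma = solve-∀

  count-unique : (g : Fin p → ℤ) (i : Fin p) → + p ∣ g i → (∀ j → + p ∣ g j → j ≡ i) →
                 ∑[ j < p ] indicator p (g j) ≡ 1ℤ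
  count-unique g i p∣gi unique =
    trans (∑-single (indicator p ∘ g) i λ j j≢i → indicator-no (j≢i ∘ unique j)) (indicator-yes p∣gi)

  -- With c an inverse of `a`, the class of cb is a solution. Two solutions have a difference that p
  -- divides after multiplication by `a`, hence already before.
  count-linear : ∀ a b → ¬ + p ∣ a → ∑[ x < p ] indicator p (a * residue x - b) ≡ 1ℤ
  count-linear a b p∤a =
    let c , ac≡1 = inverse a p∤a
        i , i≡cb = residue-surjective {p} (c * b)
        ai≡b = subst (+ p ∣_) (solution a (residue i) b c) (∣m∣n⇒∣m+n (∣n⇒∣m*n a i≡cb) (∣n⇒∣m*n b ac≡1))
    in count-unique (λ x → a * residue x - b) i ai≡b λ j aj≡b →
         residue-injective (∣*-cancelˡ p∤a
           (subst (+ p ∣_) (difference a (residue j) (residue i) b) (∣m∣n⇒∣m-n aj≡b ai≡b)))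
    where
    solution : ∀ a i b c → a * (i - c * b) + b * (a * c - 1ℤ) ≡ a * i - b
    solution = solve-∀

    difference : ∀ a j i b → (a * j - b) - (a * i - b) ≡ a * (j - i)
    difference = solve-∀

  p∤1 : ¬ + p ∣ 1ℤ
  p∤1 p∣1 = ℕ.nonTrivial⇒≢1 {{prime⇒nonTrivial pr}} (ℕ.∣1⇒≡1 (∣⇒∣ᵤ p∣1))

  count-residue : ∀ c → ∑[ x < p ] indicator p (residue x - c) ≡ 1ℤ
  count-residue c = trans
    (∑-cong {p} λ x → cong (λ y → indicator p (y - c)) (sym (*-identityˡ (residue x))))
    (count-linear 1ℤ c p∤1)

  -- Rescaling the variable of a sum over residue classes.

  Periodic : (ℤ → ℤ) → Set
  Periodic f = ∀ a b → a ≡ b [mod p ] → f a ≡ f b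

  -- The indicator acts as a Kronecker delta on classes: on its support `f (residue t)` equals the
  -- constant `f c`, which factors out and leaves the count of t ≡ c.
  ∑-sift : ∀ {f} → Periodic f → ∀ c → ∑[ t < p ] (indicator p (c - residue t) * f (residue t)) ≡ f c
  ∑-sift {f} f-cong c = begin
    ∑[ t < p ] (indicator p (c - residue t) * f (residue t))  ≡⟨ ∑-cong replace ⟩
    ∑[ t < p ] (indicator p (residue t - c) * f c)            ≡⟨ *-distribʳ-sum +-*-semiring {p} (f c) (λ t → indicator p (residue t - c)) ⟨
    ∑[ t < p ] indicator p (residue t - c) * f c              ≡⟨ cong (_* f c) (count-residue c) ⟩
    1ℤ * f c                                                  ≡⟨ *-identityˡ (f c) ⟩
    f c                                                       ∎
    where
    replace : ∀ (t : Fin p) → indicator p (c - residue t) * f (residue t) ≡ indicator p (residue t - c) * f c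
    replace t = trans
      (cong (_* f (residue t)) (indicator-⇔ (≡mod-sym p {c} {residue t}) (≡mod-sym p {residue t} {c})))
      (indicator-* {a = residue t - c} (f-cong (residue t) c))

  -- Multiplication by a unit permutes the classes. Instead of building the permutation of `Fin p`,
  -- each value is expanded by `∑-sift` and the sums are exchanged; what remains counts the s with
  -- as ≡ t, and there is exactly one.
  ∑-scale : ∀ {f} → Periodic f → ∀ a → ¬ + p ∣ a → ∑[ t < p ] f (residue t) ≡ ∑[ s < p ] f (a * residue s)
  ∑-scale {f} f-cong a p∤a = sym (begin
    ∑[ s < p ] f (a * residue s)                                                  ≡⟨ ∑-cong {p} (λ s → ∑-sift f-cong (a * residue s)) ⟨
    ∑[ s < p ] ∑[ t < p ] (indicator p (a * residue s - residue t) * f (residue t))  ≡⟨ ∑-comm M {p} {p} _ ⟩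
    ∑[ t < p ] ∑[ s < p ] (indicator p (a * residue s - residue t) * f (residue t))  ≡⟨ ∑-cong {p} collect ⟩
    ∑[ t < p ] f (residue t)                                                      ∎)
    where
    collect : ∀ (t : Fin p) → ∑[ s < p ] (indicator p (a * residue s - residue t) * f (residue t)) ≡ f (residue t)
    collect t = begin
      ∑[ s < p ] (indicator p (a * residue s - residue t) * f (residue t))  ≡⟨ *-distribʳ-sum +-*-semiring {p} (f (residue t)) (λ s → indicator p (a * residue s - residue t)) ⟨
      ∑[ s < p ] indicator p (a * residue s - residue t) * f (residue t)    ≡⟨ cong (_* f (residue t)) (count-linear a (residue t) p∤a) ⟩
      1ℤ * f (residue t)                                                    ≡⟨ *-identityˡ (f (residue t)) ⟩
      f (residue t)                                                         ∎

  -- Square roots modulo an odd prime.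

  module _ (2<p : 2 < p) where

    p∤2 : ¬ + p ∣ + 2
    p∤2 p∣2 = ℕ.>⇒∤ 2<p (∣⇒∣ᵤ p∣2)

    -- The class 0 has the single root 0, a nonzero square has the two roots r and -r, and a
    -- nonsquare has none. The decisions are taken as arguments so that these three cases are
    -- clauses.
    count-roots? : ∀ u → Dec (+ p ∣ u) → Dec (IsSquareMod p u) →
                   ∑[ y < p ] indicator p (residue y ^ 2 - u) ≡ 1ℤ + legendre u p
    count-roots? u (yes p∣u) _ = begin
      ∑[ y < p ] indicator p (residue y ^ 2 - u)   ≡⟨ ∑-cong {p} (λ y → indicator-⇔ (to (residue y)) (from (residue y))) ⟩
      ∑[ y < p ] indicator p (residue y - 0ℤ)      ≡⟨ count-residue 0ℤ ⟩
      1ℤ                                           ≡⟨ cong (_+_ 1ℤ) (legendre-zero p∣u) ⟨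
      1ℤ + legendre u p                            ∎
      where
      -- The ring identities spell powers out as `y * (y * 1ℤ)`, which is what `y ^ 2` computes to.
      lemma : ∀ y u → y * (y * 1ℤ) - u + u ≡ (y - 0ℤ) * (y - 0ℤ)
      lemma = solve-∀
      lemma′ : ∀ y u → (y - 0ℤ) * y - u ≡ y * (y * 1ℤ) - u
      lemma′ = solve-∀
      to : ∀ y → + p ∣ y ^ 2 - u → + p ∣ y - 0ℤ
      to y d = [ (λ e → e) , (λ e → e) ]′ (∣*-split (y - 0ℤ) (y - 0ℤ) (subst (+ p ∣_) (lemma y u) (∣m∣n⇒∣m+n d p∣u)))
      from : ∀ y → + p ∣ y - 0ℤ → + p ∣ y ^ 2 - u
      from y d = subst (+ p ∣_) (lemma′ y u) (∣m∣n⇒∣m-n (∣m⇒∣m*n y d) p∣u)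
    count-roots? u (no p∤u) (yes (z , z²≡u)) = begin
      ∑[ y < p ] indicator p (residue y ^ 2 - u)                                     ≡⟨ ∑-cong {p} (λ y → split (residue y)) ⟩
      ∑[ y < p ] (indicator p (residue y - r) + indicator p (residue y - - r))       ≡⟨ ∑-distrib-+ M {p} _ _ ⟩
      ∑[ y < p ] indicator p (residue y - r) + ∑[ y < p ] indicator p (residue y - - r)  ≡⟨ cong₂ _+_ (count-residue r) (count-residue (- r)) ⟩
      1ℤ + 1ℤ                                                                        ≡⟨ cong (_+_ 1ℤ) (legendre-square p∤u (z , z²≡u)) ⟨
      1ℤ + legendre u p                                                              ∎
      where
      r = residue z

      p∤r : ¬ + p ∣ r
      p∤r p∣r = p∤u (subst (+ p ∣_) (lemma r u) (∣m∣n⇒∣m-n (∣m⇒∣m*n r p∣r) z²≡u))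
        where
        lemma : ∀ r u → r * r - (r * (r * 1ℤ) - u) ≡ u
        lemma = solve-∀

      -- If y ≡ r and y ≡ -r, then 2r ≡ 0; this is where p > 2 enters.
      distinct : ∀ y → + p ∣ y - r → ¬ + p ∣ y - - r
      distinct y d e = p∤r (∣*-cancelˡ p∤2 (subst (+ p ∣_) (lemma y r) (∣m∣n⇒∣m-n e d)))
        where
        lemma : ∀ y r → (y - - r) - (y - r) ≡ + 2 * r
        lemma = solve-∀

      factor : ∀ y r u → (y - r) * (y - - r) + (r * (r * 1ℤ) - u) ≡ y * (y * 1ℤ) - u
      factor = solve-∀

      root : ∀ y → + p ∣ (y - r) * (y - - r) → + p ∣ y ^ 2 - u
      root y d = subst (+ p ∣_) (factor y r u) (∣m∣n⇒∣m+n d z²≡u)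

      -- Modulo p, y² - u is (y - r)(y + r), and the two factors never vanish together.
      split : ∀ y → indicator p (y ^ 2 - u) ≡ indicator p (y - r) + indicator p (y - - r)
      split y with + p ∣? y - r | + p ∣? y - - r
      ... | yes d | _     = trans (indicator-yes (root y (∣m⇒∣m*n (y - - r) d)))
        (sym (cong₂ _+_ (indicator-yes d) (indicator-no (distinct y d))))
      ... | no ¬d | yes e = trans (indicator-yes (root y (∣n⇒∣m*n (y - r) e)))
        (sym (cong₂ _+_ (indicator-no ¬d) (indicator-yes e)))
      ... | no ¬d | no ¬e = trans
        (indicator-no λ y²≡u → [ ¬d , ¬e ]′ (∣*-split (y - r) (y - - r)
          (∣m+n∣n⇒∣m (subst (+ p ∣_) (sym (factor y r u)) y²≡u) z²≡u)))
        (sym (cong₂ _+_ (indicator-no ¬d) (indicator-no ¬e)))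
    count-roots? u (no p∤u) (no nonsquare) = begin
      ∑[ y < p ] indicator p (residue y ^ 2 - u)   ≡⟨ ∑-zero {p} (λ y → indicator-no λ y²≡u → nonsquare (y , y²≡u)) ⟩
      0ℤ                                           ≡⟨ cong (_+_ 1ℤ) (legendre-nonsquare p∤u nonsquare) ⟨
      1ℤ + legendre u p                            ∎

    count-roots : ∀ u → ∑[ y < p ] indicator p (residue y ^ 2 - u) ≡ 1ℤ + legendre u p
    count-roots u = count-roots? u (+ p ∣? u) (isSquareMod? p u)

    -- Needed twice: for the exceptional s with s² ≡ 1, and for the v that such an s admits.
    count-roots-1 : ∑[ y < p ] indicator p (residue y ^ 2 - 1ℤ) ≡ + 2
    count-roots-1 = trans (count-roots 1ℤ) (cong (_+_ 1ℤ) (legendre-square p∤1 (i , i²≡1)))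
      where
      i = proj₁ (residue-surjective {p} 1ℤ)
      lemma : ∀ i → (i + 1ℤ) * (i - 1ℤ) ≡ i * (i * 1ℤ) - 1ℤ
      lemma = solve-∀
      i²≡1 : residue i ^ 2 ≡ 1ℤ [mod p ]
      i²≡1 = subst (+ p ∣_) (lemma (residue i)) (∣n⇒∣m*n (residue i + 1ℤ) (proj₂ (residue-surjective {p} 1ℤ)))

    -- Counting the solutions of y² = x³ - t²x + t².

    a+count : ∀ t → a⟨ t ⟩ p + ∑[ x < p ] ∑[ y < p ] indicator p (residue y ^ 2 - cubic t (residue x)) ≡ + p
    a+count t = begin
      - L + ∑[ x < p ] ∑[ y < p ] indicator p (residue y ^ 2 - cubic t (residue x))
        -- Each x carries one plus its Legendre symbol; the symbols add up to `L` and cancel against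
        -- `- L`, leaving one per x.
        ≡⟨ cong (_+_ (- L)) (∑-cong {p} λ x → count-roots (cubic t (residue x))) ⟩
      - L + ∑[ x < p ] (1ℤ + legendre (cubic t (residue x)) p)
        ≡⟨ cong (_+_ (- L)) (∑-distrib-+ M {p} _ _) ⟩
      - L + (∑[ x < p ] 1ℤ + L)
        ≡⟨ lemma L (∑[ x < p ] 1ℤ) ⟩
      ∑[ x < p ] 1ℤ
        ≡⟨ ∑-const p 1ℤ ⟩
      + p * 1ℤ
        ≡⟨ *-identityʳ (+ p) ⟩
      + p ∎
      where
      L = ∑[ x < p ] legendre (cubic t (residue x)) p
      lemma : ∀ l k → - l + (k + l) ≡ k
      lemma = solve-∀

    -- With x fixed and invertible, t = xs and y = xv are bijective changes of variable. If p
    -- divides x they are not, but then the two equations agree mod p up to sign without any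
    -- substitution.
    substitution : ∀ x →
      ∑[ t < p ] ∑[ y < p ] indicator p (residue y ^ 2 - cubic (residue t) x) ≡
      ∑[ s < p ] ∑[ v < p ] indicator p ((1ℤ - residue s ^ 2) * x - (residue v ^ 2 - residue s ^ 2))
    substitution x with + p ∣? x
    ... | yes p∣x = ∑-cong {p} λ t → ∑-cong {p} λ y →
      -- The two expressions add up to x(1 - x²), a multiple of p.
      indicator-+ (subst (+ p ∣_) (lemma x (residue t) (residue y)) (∣m⇒∣m*n (1ℤ - x ^ 2) p∣x))
      where
      lemma : ∀ x t y → x * (1ℤ - x * (x * 1ℤ)) ≡
        (y * (y * 1ℤ) - (x * (x * (x * 1ℤ)) - t * (t * 1ℤ) * x + t * (t * 1ℤ))) +
        ((1ℤ - t * (t * 1ℤ)) * x - (y * (y * 1ℤ) - t * (t * 1ℤ)))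
      lemma = solve-∀
    ... | no p∤x = begin
      ∑[ t < p ] ∑[ y < p ] indicator p (residue y ^ 2 - cubic (residue t) x)
        ≡⟨ ∑-scale t-periodic x p∤x ⟩
      ∑[ s < p ] ∑[ y < p ] indicator p (residue y ^ 2 - cubic (x * residue s) x)
        ≡⟨ ∑-cong {p} (λ s → ∑-scale (y-periodic (cubic (x * residue s) x)) x p∤x) ⟩
      ∑[ s < p ] ∑[ v < p ] indicator p ((x * residue v) ^ 2 - cubic (x * residue s) x)
        ≡⟨ ∑-cong {p} (λ s → ∑-cong {p} λ v → rescale (residue s) (residue v)) ⟩
      ∑[ s < p ] ∑[ v < p ] indicator p ((1ℤ - residue s ^ 2) * x - (residue v ^ 2 - residue s ^ 2)) ∎
      where
      -- Only the term (x - 1)t² depends on t, so x³ and y² can stand as free variables `x³` and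
      -- `u`.
      t-lemma : ∀ x x³ u s t → (x - 1ℤ) * (s + t) * (s - t) ≡
        (u - (x³ - s * (s * 1ℤ) * x + s * (s * 1ℤ))) - (u - (x³ - t * (t * 1ℤ) * x + t * (t * 1ℤ)))
      t-lemma = solve-∀
      t-periodic : Periodic (λ t → ∑[ y < p ] indicator p (residue y ^ 2 - cubic t x))
      t-periodic s t s≡t = ∑-cong {p} λ y →
        indicator-cong {a = residue y ^ 2 - cubic s x} {b = residue y ^ 2 - cubic t x}
          (subst (+ p ∣_) (t-lemma x (x ^ 3) (residue y ^ 2) s t) (∣n⇒∣m*n ((x - 1ℤ) * (s + t)) s≡t))

      y-lemma : ∀ c y z → (y + z) * (y - z) ≡ (y * (y * 1ℤ) - c) - (z * (z * 1ℤ) - c)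
      y-lemma = solve-∀
      y-periodic : ∀ c → Periodic (λ y → indicator p (y ^ 2 - c))
      y-periodic c y z y≡z = indicator-cong {a = y ^ 2 - c} {b = z ^ 2 - c}
        (subst (+ p ∣_) (y-lemma c y z) (∣n⇒∣m*n (y + z) y≡z))

      -- After the substitution the equation is -x² times the one linear in x; the units x and -x
      -- are cancelled one after the other.
      lemma : ∀ x s v →
        x * v * (x * v * 1ℤ) - (x * (x * (x * 1ℤ)) - x * s * (x * s * 1ℤ) * x + x * s * (x * s * 1ℤ)) ≡
        x * (- x * ((1ℤ - s * (s * 1ℤ)) * x - (v * (v * 1ℤ) - s * (s * 1ℤ))))
      lemma = solve-∀
      p∤-x : ¬ + p ∣ - x
      p∤-x d = p∤x (∣m+n∣n⇒∣m {m = x} (subst (+ p ∣_) (cancel x) (divides 0ℤ refl)) d)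
        where
        cancel : ∀ x → 0ℤ ≡ x + - x
        cancel = solve-∀
      rescale : ∀ s v → indicator p ((x * v) ^ 2 - cubic (x * s) x) ≡
                        indicator p ((1ℤ - s ^ 2) * x - (v ^ 2 - s ^ 2))
      rescale s v = trans (cong (indicator p) (lemma x s v)) (indicator-⇔
        (∣*-cancelˡ p∤-x ∘ ∣*-cancelˡ p∤x)
        (∣n⇒∣m*n x ∘ ∣n⇒∣m*n (- x)))

    -- If s² ≢ 1, the coefficient of x is invertible and every v has one x. If s² ≡ 1, it vanishes
    -- and every x is allowed for v² ≡ 1. The indicator joins the two totals p and 2p in one formula
    -- that can be summed over s.
    count-at : ∀ s →
      ∑[ v < p ] ∑[ x < p ] indicator p ((1ℤ - s ^ 2) * residue x - (residue v ^ 2 - s ^ 2)) ≡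
      + p + + p * indicator p (s ^ 2 - 1ℤ)
    count-at s with + p ∣? 1ℤ - s ^ 2
    ... | no s²≢1 = begin
      ∑[ v < p ] ∑[ x < p ] indicator p ((1ℤ - s ^ 2) * residue x - (residue v ^ 2 - s ^ 2))
        ≡⟨ ∑-cong {p} (λ v → count-linear (1ℤ - s ^ 2) (residue v ^ 2 - s ^ 2) s²≢1) ⟩
      ∑[ v < p ] 1ℤ
        ≡⟨ ∑-const p 1ℤ ⟩
      + p * 1ℤ
        ≡⟨ lemma (+ p) ⟩
      + p + + p * 0ℤ
        ≡⟨ cong (λ d → + p + + p * d) (indicator-no (s²≢1 ∘ ≡mod-sym p {s ^ 2} {1ℤ})) ⟨
      + p + + p * indicator p (s ^ 2 - 1ℤ) ∎
      where
      lemma : ∀ k → k * 1ℤ ≡ k + k * 0ℤ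
      lemma = solve-∀
    ... | yes s²≡1 = begin
      ∑[ v < p ] ∑[ x < p ] indicator p ((1ℤ - s ^ 2) * residue x - (residue v ^ 2 - s ^ 2))
        ≡⟨ ∑-cong {p} (λ v → ∑-cong {p} λ x → free (residue x) (residue v)) ⟩
      ∑[ v < p ] ∑[ x < p ] indicator p (residue v ^ 2 - 1ℤ)
        ≡⟨ ∑-cong {p} (λ v → ∑-const p (indicator p (residue v ^ 2 - 1ℤ))) ⟩
      ∑[ v < p ] (+ p * indicator p (residue v ^ 2 - 1ℤ))
        ≡⟨ *-distribˡ-sum +-*-semiring {p} (+ p) (λ v → indicator p (residue v ^ 2 - 1ℤ)) ⟨
      + p * ∑[ v < p ] indicator p (residue v ^ 2 - 1ℤ)
        ≡⟨ cong (+ p *_) count-roots-1 ⟩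
      + p * + 2
        ≡⟨ lemma (+ p) ⟩
      + p + + p * 1ℤ
        ≡⟨ cong (λ d → + p + + p * d) (indicator-yes (≡mod-sym p {1ℤ} {s ^ 2} s²≡1)) ⟨
      + p + + p * indicator p (s ^ 2 - 1ℤ) ∎
      where
      lemma : ∀ k → k * + 2 ≡ k + k * 1ℤ
      lemma = solve-∀
      sum-lemma : ∀ S x V → (1ℤ - S) * (x - 1ℤ) ≡ ((1ℤ - S) * x - (V - S)) + (V - 1ℤ)
      sum-lemma = solve-∀
      -- The two expressions add up to (1 - s²)(x - 1), which p divides because s² ≡ 1.
      free : ∀ x v → indicator p ((1ℤ - s ^ 2) * x - (v ^ 2 - s ^ 2)) ≡ indicator p (v ^ 2 - 1ℤ)
      free x v = indicator-+ (subst (+ p ∣_) (sum-lemma (s ^ 2) x (v ^ 2)) (∣m⇒∣m*n (x - 1ℤ) s²≡1))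

    -- The variable x first moves outermost, since the substitution rescales t and y by a fixed x,
    -- and then innermost, since the new equation is linear in it. Every s contributes p, and the
    -- two s with s² ≡ 1 contribute p more each.
    count-triples :
      ∑[ t < p ] ∑[ x < p ] ∑[ y < p ] indicator p (residue y ^ 2 - cubic (residue t) (residue x)) ≡
      + p * + p + + p * + 2
    count-triples = begin
      ∑[ t < p ] ∑[ x < p ] ∑[ y < p ] indicator p (residue y ^ 2 - cubic (residue t) (residue x))
        ≡⟨ ∑-comm M {p} {p} _ ⟩
      ∑[ x < p ] ∑[ t < p ] ∑[ y < p ] indicator p (residue y ^ 2 - cubic (residue t) (residue x))
        ≡⟨ ∑-cong {p} (λ x → substitution (residue x)) ⟩
      ∑[ x < p ] ∑[ s < p ] ∑[ v < p ] e s v x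
        ≡⟨ ∑-comm M {p} {p} _ ⟩
      ∑[ s < p ] ∑[ x < p ] ∑[ v < p ] e s v x
        ≡⟨ ∑-cong {p} (λ s → ∑-comm M {p} {p} _) ⟩
      ∑[ s < p ] ∑[ v < p ] ∑[ x < p ] e s v x
        ≡⟨ ∑-cong {p} (λ s → count-at (residue s)) ⟩
      ∑[ s < p ] (+ p + + p * indicator p (residue s ^ 2 - 1ℤ))
        ≡⟨ ∑-distrib-+ M {p} _ _ ⟩
      ∑[ s < p ] (+ p) + ∑[ s < p ] (+ p * indicator p (residue s ^ 2 - 1ℤ))
        ≡⟨ cong₂ _+_ (∑-const p (+ p)) (sym (*-distribˡ-sum +-*-semiring {p} (+ p) (λ s → indicator p (residue s ^ 2 - 1ℤ)))) ⟩
      + p * + p + + p * ∑[ s < p ] indicator p (residue s ^ 2 - 1ℤ)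
        ≡⟨ cong (λ n → + p * + p + + p * n) count-roots-1 ⟩
      + p * + p + + p * + 2 ∎
      where
      e : Fin p → Fin p → Fin p → ℤ
      e s v x = indicator p ((1ℤ - residue s ^ 2) * residue x - (residue v ^ 2 - residue s ^ 2))

-- From the number of triples to the sum over t.

mainTheorem6 : (p : ℕ) → Prime p → 2 < p → ∑[ t < p ] a⟨ residue t ⟩ p ≡ - (+ 2 * + p)
mainTheorem6 p pr 2<p = begin
  A                                        ≡⟨ move A T ⟩
  (A + T) - T                              ≡⟨ cong₂ _-_ A+T≡p² (count-triples pr 2<p) ⟩
  + p * + p - (+ p * + p + + p * + 2)      ≡⟨ lemma (+ p) ⟩
  - (+ 2 * + p)                            ∎
  where
  count : Fin p → ℤ
  count t = ∑[ x < p ] ∑[ y < p ] indicator p (residue y ^ 2 - cubic (residue t) (residue x))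
  A = ∑[ t < p ] a⟨ residue t ⟩ p
  T = ∑[ t < p ] count t

  A+T≡p² : A + T ≡ + p * + p
  A+T≡p² = begin
    A + T                                    ≡⟨ ∑-distrib-+ M {p} (λ t → a⟨ residue t ⟩ p) count ⟨
    ∑[ t < p ] (a⟨ residue t ⟩ p + count t)  ≡⟨ ∑-cong {p} (λ t → a+count pr 2<p (residue t)) ⟩
    ∑[ t < p ] (+ p)                         ≡⟨ ∑-const p (+ p) ⟩
    + p * + p                                ∎

  move : ∀ a t → a ≡ (a + t) - t
  move = solve-∀
  lemma : ∀ k → k * k - (k * k + k * + 2) ≡ - (+ 2 * k)
  lemma = solve-∀
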